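{- Fix integers $k\ge 3$ and $r\ge 1$. For integers $a\ge 0$, $0\le b\le r$ and a finite list $L=[l_1,\dots,l_t]$ ($t\ge 0$) of positive integers, let $A(r,a,b,L)$ be the number of words $w$ over the positive integers that contain exactly $r$ copies of each of the letters $1,\dots,a$, exactly $b$ copies of the letter $a+1$, exactly $l_j$ copies of the letter $a+1+j$ for $1\le j\le t$, and no other letters, such that both $w$ and the word $(a+1)w$ (obtained by prepending the letter $a+1$) avoid both patterns $123$ and $1k(k-1)\cdots 2$. (The empty word is counted.) For a list $L$, let $R(L)$ be the list obtained by deleting all entries equal to $0$. Suppose $b\ge 1$ and $t\le k-2$. Then $$A(r,a,b,L)=\sum_{i=\max(1,\ a-(k-2)+t+1)}^{a} A\big(r,\ i-1,\ r-1,\ [\underbrace{r,\dots,r}_{a-i\text{ copies}},\ b,\ l_1,\dots,l_t]\big)\ +\ A(r,a,b-1,L)\ +\ \delta_{t\ge 1}\,A\big(r,a,b,R([l_1,\dots,l_{t-1},l_t-1])\big),$$ where the sum is empty if its lower limit exceeds $a$, and $\delta_{t\ge1}$ equals $1$ if $t\ge 1$ and $0$ if $t=0$.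
   Context: A word $w_1\cdots w_m$ over the positive integers contains a pattern $p_1\cdots p_k$ if there are indices $i_1<\dots<i_k$ such that for all $r,s$: $w_{i_r}<w_{i_s}\iff p_r<p_s$ and $w_{i_r}>w_{i_s}\iff p_r>p_s$; otherwise it avoids it. The pattern $1k(k-1)\cdots 2$ is the permutation of length $k$ whose first entry is $1$ followed by $k,k-1,\dots,2$ in decreasing order (for $k=3$ it is $132$). -}

module Defs where

open import Data.Fin.Base as Fin using (Fin; zero; suc; toℕ)
import Data.Fin.Properties as Fin
open import Data.List.Base
  using (List; []; _∷_; _++_; length; lookup; map; filter; replicate; upTo; downFrom; cartesianProductWith)
open import Data.List.Membership.Propositional using (_∈_)
open import Data.List.Membership.Propositional.Properties
  using (∈-map⁺; ∈-upTo⁺; ∈-filter⁺; ∈-filter⁻; ∈-cartesianProductWith⁺)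
open import Data.List.Properties using (∷-injective; filter-accept; filter-reject)
open import Data.List.Relation.Unary.All as All using (All; []; _∷_)
open import Data.List.Relation.Unary.Any using (here)
open import Data.List.Relation.Unary.AllPairs using ([]; _∷_)
open import Data.List.Relation.Unary.Unique.Propositional using (Unique)
import Data.List.Relation.Unary.Unique.Propositional.Properties as Unique
open import Data.Nat.Base
open import Data.Nat.ListAction using (sum)
open import Data.Nat.Properties
  using (_≟_; _<?_; _≤?_; suc-injective; +-commutativeSemigroup)
open import Data.Product.Base using (∃; _×_; _,_; proj₁; proj₂)
open import Data.Vec.Functional as Vector using (Vector)
open import Algebra.Properties.CommutativeSemigroup +-commutativeSemigroup using (interchange)
open import Function.Base using (_∘_)
open import Function.Bundles using (_⇔_; mk⇔; Equivalence)
open import Relation.Binary.PropositionalEquality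
open import Relation.Nullary.Decidable using (Dec; yes; no; map′; _×-dec_; _→-dec_; ¬?)
open import Relation.Nullary.Negation using (¬_; contradiction)
open import Relation.Unary using (Pred; Decidable)
open import Level using (0ℓ)

Word : Set
Word = List ℕ

record OccursAt (p w : Word) (ι : Fin (length p) → Fin (length w)) : Set where
  constructor mkOccursAt
  field
    increasing : ∀ r s → r Fin.< s → ι r Fin.< ι s
    lessIff    : ∀ r s → lookup w (ι r) < lookup w (ι s) ⇔ lookup p r < lookup p s
    greaterIff : ∀ r s → lookup w (ι r) > lookup w (ι s) ⇔ lookup p r > lookup p s

Contains : Word → Word → Set
Contains w p = ∃ λ ι → OccursAt p w ι

Avoids : Word → Word → Set
Avoids w p = ¬ Contains w p

pattern123 : Word
pattern123 = 1 ∷ 2 ∷ 3 ∷ []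

-- The entries after the 1 are k, k-1, …, 2.
pattern1k⋯2 : ℕ → Word
pattern1k⋯2 k = 1 ∷ map (2 +_) (downFrom (k ∸ 1))

AvoidsBoth : ℕ → Word → Set
AvoidsBoth k w = Avoids w pattern123 × Avoids w (pattern1k⋯2 k)

occurrences : ℕ → Word → ℕ
occurrences x w = length (filter (x ≟_) w)

-- A list ms of multiplicities prescribes that the letter j occurs exactly as
-- often as the j-th entry of ms (counting from 1), and that no other letter occurs.
record HasContent (ms : List ℕ) (w : Word) : Set where
  constructor mkHasContent
  field
    letters        : All (λ x → 1 ≤ x × x ≤ length ms) w
    multiplicities : ∀ (j : Fin (length ms)) → occurrences (suc (toℕ j)) w ≡ lookup ms j

-- The letters 1, …, a have multiplicity r, the letter a+1 has multiplicity b,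
-- and the letter a+1+j has multiplicity l_j.
content : (r a b : ℕ) → List ℕ → List ℕ
content r a b L = replicate a r ++ b ∷ L

record Counted (k r a b : ℕ) (L : List ℕ) (w : Word) : Set where
  constructor mkCounted
  field
    hasContent     : HasContent (content r a b L) w
    avoids         : AvoidsBoth k w
    prefixedAvoids : AvoidsBoth k (suc a ∷ w)

record Enumeration (P : Pred Word 0ℓ) : Set where
  field
    elements : List Word
    unique   : Unique elements
    complete : ∀ w → w ∈ elements ⇔ P w

  cardinality : ℕ
  cardinality = length elements

_⇔-dec_ : ∀ {A B : Set} → Dec A → Dec B → Dec (A ⇔ B)
a? ⇔-dec b? = map′ (λ (f , g) → mk⇔ f g) (λ e → Equivalence.to e , Equivalence.from e)
  ((a? →-dec b?) ×-dec (b? →-dec a?))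

anyVector? : ∀ {m n} {P : Pred (Vector (Fin n) m) 0ℓ} →
             (∀ f g → f ≗ g → P f → P g) → Decidable P → Dec (∃ P)
anyVector? {zero} resp P? =
  map′ (λ p → Vector.[] , p) (λ (f , p) → resp f Vector.[] (λ ()) p) (P? Vector.[])
anyVector? {suc m} {n} {P} resp P? =
  map′ (λ (x , f , p) → (x Vector.∷ f) , p)
       (λ (f , p) → f zero , f ∘ suc , resp f _ (λ { zero → refl ; (suc i) → refl }) p)
       (Fin.any? λ x → anyVector? (λ f g f≗g → resp _ _ (cons x f≗g)) (λ f → P? (x Vector.∷ f)))
  where
  cons : ∀ x {f g : Vector (Fin n) m} → f ≗ g → (x Vector.∷ f) ≗ (x Vector.∷ g)
  cons x f≗g zero    = refl
  cons x f≗g (suc i) = f≗g i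

occursAt-resp : ∀ p w ι κ → ι ≗ κ → OccursAt p w ι → OccursAt p w κ
occursAt-resp p w ι κ e (mkOccursAt i l g) = mkOccursAt
  (λ r s → subst₂ (λ x y → r Fin.< s → x Fin.< y) (e r) (e s) (i r s))
  (λ r s → subst₂ (λ x y → lookup w x < lookup w y ⇔ lookup p r < lookup p s) (e r) (e s) (l r s))
  (λ r s → subst₂ (λ x y → lookup w x > lookup w y ⇔ lookup p r > lookup p s) (e r) (e s) (g r s))

occursAt? : ∀ p w → Decidable (OccursAt p w)
occursAt? p w ι =
  map′ (λ (i , l , g) → mkOccursAt i l g) (λ (mkOccursAt i l g) → i , l , g)
    (   (Fin.all? λ r → Fin.all? λ s → (r Fin.<? s) →-dec (ι r Fin.<? ι s))
    ×-dec (Fin.all? λ r → Fin.all? λ s →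
            (lookup w (ι r) <? lookup w (ι s)) ⇔-dec (lookup p r <? lookup p s))
    ×-dec (Fin.all? λ r → Fin.all? λ s →
            (lookup w (ι s) <? lookup w (ι r)) ⇔-dec (lookup p s <? lookup p r)))

avoids? : ∀ w p → Dec (Avoids w p)
avoids? w p = ¬? (anyVector? (occursAt-resp p w) (occursAt? p w))

avoidsBoth? : ∀ k → Decidable (AvoidsBoth k)
avoidsBoth? k w = avoids? w pattern123 ×-dec avoids? w (pattern1k⋯2 k)

hasContent? : ∀ ms → Decidable (HasContent ms)
hasContent? ms w =
  map′ (λ (l , m) → mkHasContent l m) (λ (mkHasContent l m) → l , m)
    (   All.all? (λ x → (1 ≤? x) ×-dec (x ≤? length ms)) w
    ×-dec Fin.all? (λ j → occurrences (suc (toℕ j)) w ≟ lookup ms j))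

counted? : ∀ k r a b L → Decidable (Counted k r a b L)
counted? k r a b L w =
  map′ (λ (c , v , p) → mkCounted c v p) (λ (mkCounted c v p) → c , v , p)
    (hasContent? (content r a b L) w ×-dec avoidsBoth? k w ×-dec avoidsBoth? k (suc a ∷ w))

words : (n m : ℕ) → List Word
words zero    m = [] ∷ []
words (suc n) m = cartesianProductWith _∷_ (map suc (upTo m)) (words n m)

words-unique : ∀ n m → Unique (words n m)
words-unique zero    m = [] ∷ []
words-unique (suc n) m = Unique.cartesianProductWith⁺ _∷_ ∷-injective
  (Unique.map⁺ suc-injective (Unique.upTo⁺ m)) (words-unique n m)

∈-words : ∀ {m} w → All (λ x → 1 ≤ x × x ≤ m) w → w ∈ words (length w) m
∈-words []          []                 = here refl
∈-words (suc x ∷ w) ((_ , x<m) ∷ rest) =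
  ∈-cartesianProductWith⁺ _∷_ (∈-map⁺ suc (∈-upTo⁺ x<m)) (∈-words w rest)

sumFin : ℕ → (ℕ → ℕ) → ℕ
sumFin zero    f = 0
sumFin (suc n) f = f 0 + sumFin n (f ∘ suc)

sumFin-cong : ∀ n {f g} → (∀ i → f i ≡ g i) → sumFin n f ≡ sumFin n g
sumFin-cong zero    e = refl
sumFin-cong (suc n) e = cong₂ _+_ (e 0) (sumFin-cong n (e ∘ suc))

sumFin-0 : ∀ n → sumFin n (λ _ → 0) ≡ 0
sumFin-0 zero    = refl
sumFin-0 (suc n) = sumFin-0 n

sumFin-+ : ∀ n f g → sumFin n (λ i → f i + g i) ≡ sumFin n f + sumFin n g
sumFin-+ zero    f g = refl
sumFin-+ (suc n) f g = trans (cong (f 0 + g 0 +_) (sumFin-+ n (f ∘ suc) (g ∘ suc)))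
  (interchange (f 0) (g 0) _ _)

indicator : ℕ → ℕ → ℕ
indicator zero    zero    = 1
indicator zero    (suc x) = 0
indicator (suc i) zero    = 0
indicator (suc i) (suc x) = indicator i x

sumFin-indicator : ∀ {n x} → x < n → sumFin n (λ i → indicator i x) ≡ 1
sumFin-indicator {suc n} {zero}  _       = cong suc (sumFin-0 n)
sumFin-indicator {suc n} {suc x} (s≤s p) = sumFin-indicator p

indicator-refl : ∀ i → indicator i i ≡ 1
indicator-refl zero    = refl
indicator-refl (suc i) = indicator-refl i

indicator-≢ : ∀ i x → i ≢ x → indicator i x ≡ 0
indicator-≢ zero    zero    n = contradiction refl n
indicator-≢ zero    (suc x) n = refl
indicator-≢ (suc i) zero    n = refl
indicator-≢ (suc i) (suc x) n = indicator-≢ i x (n ∘ cong suc)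

occurrences-∷ : ∀ i x w →
  occurrences (suc i) (suc x ∷ w) ≡ indicator i x + occurrences (suc i) w
occurrences-∷ i x w with i ≟ x
... | yes refl = trans (cong length (filter-accept (suc i ≟_) refl))
                       (cong (_+ occurrences (suc i) w) (sym (indicator-refl i)))
... | no  i≢x  = trans (cong length (filter-reject (suc i ≟_) (i≢x ∘ suc-injective)))
                       (cong (_+ occurrences (suc i) w) (sym (indicator-≢ i x i≢x)))

sum-occurrences : ∀ {m} w → All (λ x → 1 ≤ x × x ≤ m) w →
  sumFin m (λ i → occurrences (suc i) w) ≡ length w
sum-occurrences {m} []          []                 = sumFin-0 m
sum-occurrences {m} (suc x ∷ w) ((_ , x<m) ∷ rest) =
  trans (sumFin-cong m (λ i → occurrences-∷ i x w))
  (trans (sumFin-+ m (λ i → indicator i x) (λ i → occurrences (suc i) w))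
  (cong₂ _+_ (sumFin-indicator x<m) (sum-occurrences w rest)))

sumFin-lookup : ∀ ms (f : ℕ → ℕ) → (∀ j → f (toℕ j) ≡ lookup ms j) →
  sumFin (length ms) f ≡ sum ms
sumFin-lookup []       f e = refl
sumFin-lookup (m ∷ ms) f e = cong₂ _+_ (e zero) (sumFin-lookup ms (f ∘ suc) (e ∘ suc))

length-content : ∀ {ms w} → HasContent ms w → length w ≡ sum ms
length-content {ms} {w} (mkHasContent l m) =
  trans (sym (sum-occurrences w l)) (sumFin-lookup ms (λ i → occurrences (suc i) w) m)

enumerate : ∀ {P : Pred Word 0ℓ} ms → Decidable P → (∀ w → P w → HasContent ms w) →
            Enumeration P
enumerate {P} ms P? P⇒content = record
  { elements = filter P? ws
  ; unique   = Unique.filter⁺ P? (words-unique (sum ms) (length ms))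
  ; complete = λ w → mk⇔ (λ w∈ → proj₂ (∈-filter⁻ P? {xs = ws} w∈)) (λ p → ∈-filter⁺ P? (w∈ws w p) p)
  }
  where
  ws : List Word
  ws = words (sum ms) (length ms)

  w∈ws : ∀ w → P w → w ∈ ws
  w∈ws w p = subst (λ n → w ∈ words n (length ms)) (length-content c) (∈-words w (HasContent.letters c))
    where
    c : HasContent ms w
    c = P⇒content w p

enumeration : ∀ k r a b L → Enumeration (Counted k r a b L)
enumeration k r a b L =
  enumerate (content r a b L) (counted? k r a b L) (λ w → Counted.hasContent)

A : (k r a b : ℕ) → List ℕ → ℕ
A k r a b L = Enumeration.cardinality (enumeration k r a b L)

R : List ℕ → List ℕ
R = filter (λ l → ¬? (l ≟ 0))

decrementLast : List ℕ → List ℕ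
decrementLast []           = []
decrementLast (l ∷ [])     = (l ∸ 1) ∷ []
decrementLast (l ∷ m ∷ ls) = l ∷ decrementLast (m ∷ ls)

δ[_≥1] : ℕ → ℕ
δ[ zero  ≥1] = 0
δ[ suc _ ≥1] = 1

sumFromTo : ℕ → ℕ → (ℕ → ℕ) → ℕ
sumFromTo lo hi f = sum (map (λ j → f (lo + j)) (upTo (suc hi ∸ lo)))


-- max(1, a-(k-2)+t+1): since the maximum is taken with 1, subtracting last
-- makes the truncated difference agree with the integer one.
lowerLimit : (k a t : ℕ) → ℕ
lowerLimit k a t = 1 ⊔ ((a + t + 1) ∸ (k ∸ 2))

{-# OPTIONS --safe #-}

-- Sort the counted words by their first letter x, and let c = a+1 be the prefixed
-- letter. Each forbidden pattern is a letter followed by a monotone run of larger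
-- letters, so c in front of some x ≤ c imposes nothing that x does not impose
-- already: deleting the first letter x ≤ a+1 leaves the words counted by the sum
-- and by A(r,a,b-1,L). For x ≤ a the letters above x have to appear in weakly
-- decreasing order, and k-1 distinct ones would complete 1k⋯2; this is the lower
-- limit of the sum. For x > c, avoiding 123 makes x the largest letter a+1+t, which
-- can be deleted and reinserted freely because only t ≤ k-2 letters exceed c.
module Submission where

open import Defs
open import Data.Empty using (⊥; ⊥-elim)
open import Data.Fin.Base as Fin using (Fin; zero; suc; toℕ; cast)
import Data.Fin.Properties as Fin
open import Data.List.Base
  using (List; []; _∷_; _++_; length; lookup; map; replicate; tabulate; upTo; downFrom; concatMap;
         initLast; _∷ʳ′_)
open import Data.List.Membership.Propositional using (_∈_; _∉_; find; lose)
open import Data.List.Membership.Propositional.Properties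
  using (∈-lookup; ∈-map⁺; ∈-map⁻; ∈-++⁺ˡ; ∈-++⁺ʳ; ∈-++⁻; ∈-concatMap⁺; ∈-concatMap⁻; ∈-upTo⁺; ∈-upTo⁻)
open import Data.List.Membership.Propositional.Properties.WithK using (unique∧set⇒bag)
open import Data.List.Properties
  using (∷-injectiveˡ; ∷-injectiveʳ; ++-assoc; ++-identityʳ; map-cong; tabulate-cong; length-++; length-map;
         length-replicate; length-tabulate; length-downFrom; filter-all; filter-none; filter-some;
         filter-accept; filter-reject; filter-++)
open import Data.List.Relation.Binary.BagAndSetEquality using (∼bag⇒↭)
open import Data.List.Relation.Binary.Permutation.Propositional.Properties using (↭-length)
open import Data.List.Relation.Binary.Sublist.Propositional using (_⊆_; _∷_; _∷ʳ_; minimum; from∈; ⊆-refl; ⊆-trans)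
open import Data.List.Relation.Binary.Sublist.Propositional.Properties using (All-resp-⊆)
open import Data.List.Relation.Unary.All as All using (All; []; _∷_)
import Data.List.Relation.Unary.All.Properties as All
open import Data.List.Relation.Unary.AllPairs as AllPairs using (AllPairs; []; _∷_)
import Data.List.Relation.Unary.AllPairs.Properties as AllPairs
open import Data.List.Relation.Unary.Any using (here; there)
import Data.List.Relation.Unary.Unique.Propositional.Properties as Unique
open import Data.Nat.Base
open import Data.Nat.ListAction using (sum)
open import Data.Nat.Properties
open import Data.List.Membership.DecPropositional _≟_ using (_∈?_)
open import Data.Product.Base using (∃; _×_; _,_; proj₁; proj₂)
open import Data.Sum.Base as Sum using (_⊎_; inj₁; inj₂)
open import Function.Base using (_∘_; id)
open import Function.Bundles using (_⇔_; mk⇔; Equivalence)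
open import Level using (0ℓ)
open import Relation.Binary.Core using (Rel)
open import Relation.Binary.Definitions using (Tri; tri<; tri≈; tri>)
open import Relation.Binary.PropositionalEquality
open import Relation.Nullary.Decidable using (yes; no)
open import Relation.Nullary.Negation using (¬_; contradiction)
open import Relation.Unary using (Pred)

open Enumeration using (cardinality)
open Equivalence using (to; from)

-- Forbidden patterns as low runs.

data Trend : Set where
  up down : Trend

step : Trend → Rel ℕ 0ℓ
step up   = _<_
step down = _>_

-- Both forbidden patterns have this shape: a letter followed by a monotone
-- sequence of n larger letters.
record LowRun (d : Trend) (n : ℕ) (w : Word) : Set where
  constructor mkLowRun
  field
    {low}    : ℕ
    {run}    : Word
    sublist  : low ∷ run ⊆ w
    above    : All (low <_) run
    monotone : AllPairs (step d) run
    len      : length run ≡ n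

-- Equality is left out because the letters of a low run are pairwise distinct, and so are the
-- entries of both patterns.
SameOrder : ℕ → ℕ → ℕ → ℕ → Set
SameOrder x y x′ y′ = (x < y × x′ < y′) ⊎ (x > y × x′ > y′)

sameOrder-< : ∀ {x y x′ y′} → SameOrder x y x′ y′ → x < y ⇔ x′ < y′
sameOrder-< (inj₁ (p , q)) = mk⇔ (λ _ → q) (λ _ → p)
sameOrder-< (inj₂ (p , q)) = mk⇔ (λ p′ → contradiction p′ (<-asym p)) (λ q′ → contradiction q′ (<-asym q))

sameOrder-> : ∀ {x y x′ y′} → SameOrder x y x′ y′ → x > y ⇔ x′ > y′
sameOrder-> (inj₁ (p , q)) = mk⇔ (λ p′ → contradiction p′ (<-asym p)) (λ q′ → contradiction q′ (<-asym q))
sameOrder-> (inj₂ (p , q)) = mk⇔ (λ _ → q) (λ _ → p)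

step-sameOrder : ∀ d {x y x′ y′} → step d x y → step d x′ y′ → SameOrder x y x′ y′
step-sameOrder up   p q = inj₁ (p , q)
step-sameOrder down p q = inj₂ (p , q)

step-resp : ∀ d {x y x′ y′} → x < y ⇔ x′ < y′ → x > y ⇔ x′ > y′ → step d x′ y′ → step d x y
step-resp up   lt gt = from lt
step-resp down lt gt = from gt

-- Position maps and sublists.

StrictlyIncreasing : ∀ {m n} → (Fin m → Fin n) → Set
StrictlyIncreasing ι = ∀ r s → r Fin.< s → ι r Fin.< ι s

-- Pairs of positions in increasing order suffice: a reversed pair exchanges the two equivalences,
-- and at equal positions both sides of each are false.
occursAt : ∀ {p w} (ι : Fin (length p) → Fin (length w)) → StrictlyIncreasing ι →
  (∀ r s → r Fin.< s → SameOrder (lookup w (ι r)) (lookup w (ι s)) (lookup p r) (lookup p s)) →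
  OccursAt p w ι
occursAt {p} {w} ι mono same = mkOccursAt mono (λ r s → proj₁ (both r s)) (λ r s → proj₂ (both r s))
  where
  both : ∀ r s → (lookup w (ι r) < lookup w (ι s) ⇔ lookup p r < lookup p s)
               × (lookup w (ι r) > lookup w (ι s) ⇔ lookup p r > lookup p s)
  both r s with Fin.<-cmp r s
  ... | tri< r<s _ _  = sameOrder-< (same r s r<s) , sameOrder-> (same r s r<s)
  ... | tri≈ _ refl _ = irreflexive , irreflexive
    where
    irreflexive : ∀ {x y} → x < x ⇔ y < y
    irreflexive = mk⇔ (⊥-elim ∘ n≮n _) (⊥-elim ∘ n≮n _)
  ... | tri> _ _ s<r  = sameOrder-> (same s r s<r) , sameOrder-< (same s r s<r)

embed : ∀ {u w : Word} → u ⊆ w → Fin (length u) → Fin (length w)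
embed (_ ∷ʳ u⊆w) i       = suc (embed u⊆w i)
embed (_ ∷ u⊆w)  zero    = zero
embed (_ ∷ u⊆w)  (suc i) = suc (embed u⊆w i)

embed-mono : ∀ {u w : Word} (u⊆w : u ⊆ w) → StrictlyIncreasing (embed u⊆w)
embed-mono (_ ∷ʳ u⊆w) i       j       i<j       = s≤s (embed-mono u⊆w i j i<j)
embed-mono (_ ∷ u⊆w)  zero    (suc j) _         = z<s
embed-mono (_ ∷ u⊆w)  (suc i) (suc j) (s≤s i<j) = s≤s (embed-mono u⊆w i j i<j)

lookup-embed : ∀ {u w : Word} (u⊆w : u ⊆ w) i → lookup w (embed u⊆w i) ≡ lookup u i
lookup-embed (_ ∷ʳ u⊆w)   i       = lookup-embed u⊆w i
lookup-embed (refl ∷ u⊆w) zero    = refl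
lookup-embed (refl ∷ u⊆w) (suc i) = lookup-embed u⊆w i

mutual
  tabulate-⊆ : ∀ {n} (w : Word) (ι : Fin n → Fin (length w)) → StrictlyIncreasing ι →
    tabulate (lookup w ∘ ι) ⊆ w
  tabulate-⊆ {zero}  w       ι mono = minimum w
  tabulate-⊆ {suc n} []      ι mono = contradiction (ι zero) λ ()
  tabulate-⊆ {suc n} (x ∷ w) ι mono with ι zero in ι₀
  ... | zero  = refl ∷ tabulate-⊆-tail w (ι ∘ suc) (λ r s → mono (suc r) (suc s) ∘ s≤s)
                  (λ r → subst (Fin._< ι (suc r)) ι₀ (mono zero (suc r) z<s))
  -- No index is sent to position zero, so `x` is skipped. The transport along `ι₀` replaces
  -- `ι zero` by the value `suc i` that the goal now shows.
  ... | suc i = x ∷ʳ subst (λ j → lookup (x ∷ w) j ∷ tabulate (lookup (x ∷ w) ∘ ι ∘ suc) ⊆ w) ι₀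
                  (tabulate-⊆-tail w ι mono
                    (λ { zero    → subst (zero {length w} Fin.<_) (sym ι₀) z<s
                       ; (suc r) → ≤-<-trans z≤n (mono zero (suc r) z<s) }))

  -- A map that misses zero factors through `suc`, so the letter `x` is never read. `punchOut` at
  -- zero serves as the predecessor.
  tabulate-⊆-tail : ∀ {n x} (w : Word) (ι : Fin n → Fin (suc (length w))) → StrictlyIncreasing ι →
    (∀ r → zero {length w} Fin.< ι r) → tabulate (lookup (x ∷ w) ∘ ι) ⊆ w
  tabulate-⊆-tail {x = x} w ι mono 0<ι =
    subst (_⊆ w) (tabulate-cong (λ r → cong (lookup (x ∷ w)) (suc-pred≡ι r)))
      (tabulate-⊆ w pred-ι λ r s r<s →
        s<s⁻¹ (subst₂ Fin._<_ (sym (suc-pred≡ι r)) (sym (suc-pred≡ι s)) (mono r s r<s)))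
    where
    pred-ι : ∀ r → Fin (length w)
    pred-ι r = Fin.punchOut (Fin.<⇒≢ (0<ι r))

    suc-pred≡ι : ∀ r → suc (pred-ι r) ≡ ι r
    suc-pred≡ι r = Fin.punchIn-punchOut (Fin.<⇒≢ (0<ι r))

AllPairs-lookup : ∀ {R : Rel ℕ 0ℓ} {xs} → AllPairs R xs → ∀ i j → i Fin.< j → R (lookup xs i) (lookup xs j)
AllPairs-lookup (px ∷ _)  zero    (suc j) _         = All.lookup px (∈-lookup j)
AllPairs-lookup (_ ∷ pxs) (suc i) (suc j) (s≤s i<j) = AllPairs-lookup pxs i j i<j

-- Containment of a pattern as existence of a low run.

module _ (d : Trend) {q qs} (q<qs : All (q <_) qs) (mono-qs : AllPairs (step d) qs) where

  contains⇒run : ∀ {w} → Contains w (q ∷ qs) → LowRun d (length qs) w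
  contains⇒run {w} (ι , mkOccursAt mono lt gt) = record
    { sublist  = tabulate-⊆ w ι mono
    ; above    = All.tabulate⁺ λ i → from (lt zero (suc i)) (All.lookup q<qs (∈-lookup i))
    ; monotone = AllPairs.tabulate⁺-< λ {i} {j} i<j →
        step-resp d (lt (suc i) (suc j)) (gt (suc i) (suc j)) (AllPairs-lookup mono-qs i j i<j)
    ; len      = length-tabulate (lookup w ∘ ι ∘ suc)
    }

  -- A least letter followed by a monotone run of given direction and length has only one order
  -- type, so any low run is order isomorphic to the pattern.
  run⇒contains : ∀ {w} → LowRun d (length qs) w → Contains w (q ∷ qs)
  run⇒contains {w} (mkLowRun {x} {ys} x∷ys⊆w x<ys mono-ys len) = ι , occursAt ι ι-mono
      λ r s r<s → subst₂ (λ u v → SameOrder u v (lookup (q ∷ qs) r) (lookup (q ∷ qs) s))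
                    (sym (lookup-embed x∷ys⊆w (κ r))) (sym (lookup-embed x∷ys⊆w (κ s))) (same r s r<s)
    where
    κ : Fin (suc (length qs)) → Fin (suc (length ys))
    κ = cast (cong suc (sym len))

    κ-mono : StrictlyIncreasing κ
    κ-mono r s = subst₂ _<_ (sym (Fin.toℕ-cast _ r)) (sym (Fin.toℕ-cast _ s))

    ι : Fin (suc (length qs)) → Fin (length w)
    ι = embed x∷ys⊆w ∘ κ

    ι-mono : StrictlyIncreasing ι
    ι-mono r s r<s = embed-mono _ (κ r) (κ s) (κ-mono r s r<s)

    same : ∀ r s → r Fin.< s → SameOrder (lookup (x ∷ ys) (κ r)) (lookup (x ∷ ys) (κ s))
                                         (lookup (q ∷ qs) r) (lookup (q ∷ qs) s)
    same zero    (suc s) _         = inj₁ (All.lookup x<ys (∈-lookup _) , All.lookup q<qs (∈-lookup s))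
    same (suc r) (suc s) (s≤s r<s) = step-sameOrder d
      (AllPairs-lookup mono-ys _ _ (s<s⁻¹ (κ-mono (suc r) (suc s) (s≤s r<s))))
      (AllPairs-lookup mono-qs r s r<s)

-- The lengths are 2 and `k ∸ 1` because the entry 1 of each pattern is the low letter and does not
-- belong to the run.
record NoRuns (k : ℕ) (w : Word) : Set where
  constructor mkNoRuns
  field
    noUp   : ¬ LowRun up 2 w
    noDown : ¬ LowRun down (k ∸ 1) w

module _ {k : ℕ} where

  private
    qs : Word
    qs = map (2 +_) (downFrom (k ∸ 1))

    len : length qs ≡ k ∸ 1
    len = trans (length-map (2 +_) (downFrom (k ∸ 1))) (length-downFrom (k ∸ 1))

    1<qs : All (1 <_) qs
    1<qs = All.map⁺ (All.universal (λ _ → s≤s (s≤s z≤n)) (downFrom (k ∸ 1)))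

    qs-down : AllPairs _>_ qs
    qs-down = AllPairs.map⁺ (AllPairs.applyDownFrom⁺₁ id (k ∸ 1) (λ j<i _ → s≤s (s≤s j<i)))

    1<2∷3 : All (1 <_) (2 ∷ 3 ∷ [])
    1<2∷3 = ≤-refl ∷ s≤s (s≤s z≤n) ∷ []

    2<3 : AllPairs _<_ (2 ∷ 3 ∷ [])
    2<3 = (≤-refl ∷ []) ∷ [] ∷ []

  avoidsBoth⇔noRuns : ∀ {w} → AvoidsBoth k w ⇔ NoRuns k w
  avoidsBoth⇔noRuns {w} = mk⇔
    (λ (¬c , ¬d) → mkNoRuns (¬c ∘ run⇒contains up 1<2∷3 2<3)
      (¬d ∘ run⇒contains down 1<qs qs-down ∘ subst (λ n → LowRun down n w) (sym len)))
    (λ (mkNoRuns ¬r ¬s) → ¬r ∘ contains⇒run up 1<2∷3 2<3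
                 , ¬s ∘ subst (λ n → LowRun down n w) len ∘ contains⇒run down 1<qs qs-down)

-- Deleting and inserting letters under avoidance.

lowRun-⊆ : ∀ {d n u w} → u ⊆ w → LowRun d n u → LowRun d n w
lowRun-⊆ u⊆w (mkLowRun s a m l) = mkLowRun (⊆-trans s u⊆w) a m l

noRuns-⊆ : ∀ {k u w} → u ⊆ w → NoRuns k w → NoRuns k u
noRuns-⊆ u⊆w (mkNoRuns ¬u ¬d) = mkNoRuns (¬u ∘ lowRun-⊆ u⊆w) (¬d ∘ lowRun-⊆ u⊆w)

⊆-skip : ∀ {c x w} {ys : Word} → x ≤ c → All (c <_) ys → ys ⊆ x ∷ w → ys ⊆ w
⊆-skip x≤c c<ys       (_ ∷ʳ s)   = s
⊆-skip x≤c (c<y ∷ _) (refl ∷ s) = contradiction c<y (≤⇒≯ x≤c)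

-- If `c` is the low letter, then `x` is too small to belong to the run, and `x` can replace `c` as
-- the low letter.
lowRun-absorb : ∀ {d n c x w} → x ≤ c → LowRun d n (c ∷ x ∷ w) → LowRun d n (x ∷ w)
lowRun-absorb x≤c (mkLowRun (_ ∷ʳ s) c<ys m l) = mkLowRun s c<ys m l
lowRun-absorb x≤c (mkLowRun (refl ∷ s) c<ys m l) =
  mkLowRun (refl ∷ ⊆-skip x≤c c<ys s) (All.map (≤-<-trans x≤c) c<ys) m l

noRuns-absorb : ∀ {k c x w} → x ≤ c → NoRuns k (x ∷ w) → NoRuns k (c ∷ x ∷ w)
noRuns-absorb x≤c (mkNoRuns ¬u ¬d) = mkNoRuns (¬u ∘ lowRun-absorb x≤c) (¬d ∘ lowRun-absorb x≤c)

-- Induction on the number `t` of available values: everything after the head lies below it, which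
-- lowers the upper bound by one.
descending-length : ∀ {c t ys} → AllPairs _>_ ys → All (c <_) ys → All (_≤ c + t) ys → length ys ≤ t
descending-length [] [] [] = z≤n
descending-length {c} {zero}  (_ ∷ _) (c<y ∷ _) (y≤c+0 ∷ _) =
  contradiction (subst (_ ≤_) (+-identityʳ c) y≤c+0) (<⇒≱ c<y)
descending-length {c} {suc t} (y>ys ∷ mono) (_ ∷ c<ys) (y≤c+t ∷ _) = s≤s
  (descending-length mono c<ys
    (All.map (λ {z} z<y → s≤s⁻¹ (subst (z <_) (+-suc c t) (<-≤-trans z<y y≤c+t))) y>ys))

-- The inserted letter is maximal, so it is neither a low letter nor the start of a rise. A
-- decreasing run above `c` takes its letters from `t` values, fewer than the `k ∸ 1` that a
-- forbidden run needs.
noRuns-insertMax : ∀ {k c t w} → 3 ≤ k → t ≤ k ∸ 2 → All (_≤ c + t) w →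
  NoRuns k (c ∷ w) → NoRuns k (c ∷ c + t ∷ w)
noRuns-insertMax {suc (suc k)} {c} {t} {w} (s≤s (s≤s 1≤k)) t≤k w≤max (mkNoRuns ¬u ¬d) =
  mkNoRuns (¬u ∘ dropUp) (¬d ∘ dropDown)
  where
  nothingAbove : ∀ {ys} → 0 < length ys → ys ⊆ w → All (c + t <_) ys → ⊥
  nothingAbove {_ ∷ _} _ s (max<y ∷ _) = <⇒≱ max<y (All.head (All-resp-⊆ s w≤max))

  dropUp : LowRun up 2 (c ∷ c + t ∷ w) → LowRun up 2 (c ∷ w)
  dropUp (mkLowRun (_ ∷ʳ _ ∷ʳ s)     a m l) = mkLowRun (c ∷ʳ s) a m l
  dropUp (mkLowRun (_ ∷ʳ refl ∷ s)   a m l) = ⊥-elim (nothingAbove (subst (0 <_) (sym l) z<s) s a)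
  dropUp (mkLowRun (refl ∷ _ ∷ʳ s)   a m l) = mkLowRun (refl ∷ s) a m l
  dropUp (mkLowRun (refl ∷ refl ∷ s) a (max<ys ∷ m) l) =
    ⊥-elim (nothingAbove (subst (0 <_) (sym (suc-injective l)) z<s) s max<ys)

  dropDown : LowRun down (suc k) (c ∷ c + t ∷ w) → LowRun down (suc k) (c ∷ w)
  dropDown (mkLowRun (_ ∷ʳ _ ∷ʳ s)     a m l) = mkLowRun (c ∷ʳ s) a m l
  dropDown (mkLowRun (_ ∷ʳ refl ∷ s)   a m l) = ⊥-elim (nothingAbove (subst (0 <_) (sym l) z<s) s a)
  dropDown (mkLowRun (refl ∷ s)        a m l) = ⊥-elim (<⇒≱ (s≤s t≤k)
    (subst (_≤ t) l (descending-length m a (All-resp-⊆ s (≤-refl ∷ w≤max)))))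

-- A larger `z` would complete the occurrence `c`, `x`, `z` of 123.
∈-maximal : ∀ {k c x z w} → NoRuns k (c ∷ x ∷ w) → c < x → z ∈ w → z ≤ x
∈-maximal {x = x} {z} (mkNoRuns ¬u _) c<x z∈w with z ≤? x
... | yes z≤x = z≤x
... | no  z≰x = contradiction
  (mkLowRun (refl ∷ refl ∷ from∈ z∈w) (c<x ∷ <-trans c<x (≰⇒> z≰x) ∷ []) ((≰⇒> z≰x ∷ []) ∷ [] ∷ []) refl) ¬u

∈-tail : ∀ {x z : ℕ} {w} → z ≢ x → z ∈ x ∷ w → z ∈ w
∈-tail z≢x (here z≡x)  = contradiction z≡x z≢x
∈-tail z≢x (there z∈w) = z∈w

-- Decreasing runs forced by avoiding 123.

descent : ℕ → ℕ → Word
descent i m = map (suc i +_) (downFrom m)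

-- With no rise among the letters above i, the last occurrences of these letters
-- come in decreasing order.
descent-⊆ : ∀ i m w → (∀ {y z} → i < y → y < z → ¬ (y ∷ z ∷ [] ⊆ w)) →
  (∀ j → j < m → suc i + j ∈ w) → descent i m ⊆ w
descent-⊆ i zero    w       noRise j∈w = minimum w
descent-⊆ i (suc m) []      noRise j∈w with () ← j∈w m ≤-refl
descent-⊆ i (suc m) (x ∷ w) noRise j∈w with suc i + m ≟ x
... | yes refl = refl ∷ descent-⊆ i m w (λ i<y y<z s → noRise i<y y<z (x ∷ʳ s))
  λ j j<m → ∈-tail (<⇒≢ (+-monoʳ-< (suc i) j<m)) (j∈w j (m<n⇒m<1+n j<m))
... | no top≢x = x ∷ʳ descent-⊆ i (suc m) w (λ i<y y<z s → noRise i<y y<z (x ∷ʳ s))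
  λ j j≤m → ∈-tail (j≢x j j≤m) (j∈w j j≤m)
  where
  j≢x : ∀ j → j < suc m → suc i + j ≢ x
  j≢x j j≤m refl with m≤n⇒m<n∨m≡n (s≤s⁻¹ j≤m)
  -- Here `x` is a lower letter of the descent and the top letter `suc i + m` still comes after it,
  -- which is a rise above `i`.
  ... | inj₁ j<m  = noRise (m≤m+n (suc i) j) (+-monoʳ-< (suc i) j<m)
                      (refl ∷ from∈ (∈-tail top≢x (j∈w m ≤-refl)))
  ... | inj₂ refl = top≢x refl

-- A rise above `i` would be a 123 starting at `i`. Without rises, the `k ∸ 1` letters following `i`
-- in value would form a decreasing sublist, and `i` in front of it gives `1k⋯2`.
noRuns-gap : ∀ {k i w} → NoRuns k (i ∷ w) → ¬ (∀ j → j < k ∸ 1 → suc i + j ∈ w)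
noRuns-gap {k} {i} {w} (mkNoRuns ¬u ¬d) j∈w = ¬d (mkLowRun
  (refl ∷ descent-⊆ i (k ∸ 1) w
    (λ i<y y<z s → ¬u (mkLowRun (refl ∷ s) (i<y ∷ <-trans i<y y<z ∷ []) ((y<z ∷ []) ∷ [] ∷ []) refl)) j∈w)
  (All.map⁺ (All.universal (m≤m+n (suc i)) (downFrom (k ∸ 1))))
  (AllPairs.map⁺ (AllPairs.applyDownFrom⁺₁ id (k ∸ 1) (λ j<i _ → +-monoʳ-< (suc i) j<i)))
  (trans (length-map (suc i +_) (downFrom (k ∸ 1))) (length-downFrom (k ∸ 1))))

-- Multiplicities and the content of a word.

entry : List ℕ → ℕ → ℕ
entry []       _       = 0
entry (m ∷ ms) zero    = m
entry (m ∷ ms) (suc j) = entry ms j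

entry-lookup : ∀ ms (j : Fin (length ms)) → entry ms (toℕ j) ≡ lookup ms j
entry-lookup (m ∷ ms) zero    = refl
entry-lookup (m ∷ ms) (suc j) = entry-lookup ms j

entry-beyond : ∀ ms {j} → length ms ≤ j → entry ms j ≡ 0
entry-beyond []       _           = refl
entry-beyond (_ ∷ ms) (s≤s len≤j) = entry-beyond ms len≤j

entry-positive : ∀ {ms j} → All (1 ≤_) ms → j < length ms → 0 < entry ms j
entry-positive {_ ∷ _} {zero}  (0<m ∷ _)  _         = 0<m
entry-positive {_ ∷ _} {suc j} (_ ∷ 0<ms) (s≤s j<n) = entry-positive 0<ms j<n

-- The default value 0 of `entry` hides a trailing zero, so a largest letter that has been used up
-- may be kept in the list or dropped.
entry-∷ʳ-0 : ∀ ms j → entry (ms ++ 0 ∷ []) j ≡ entry ms j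
entry-∷ʳ-0 []       zero    = refl
entry-∷ʳ-0 []       (suc j) = refl
entry-∷ʳ-0 (m ∷ ms) zero    = refl
entry-∷ʳ-0 (m ∷ ms) (suc j) = entry-∷ʳ-0 ms j

entry-suc : ∀ us m vs j → entry (us ++ suc m ∷ vs) j ≡ indicator j (length us) + entry (us ++ m ∷ vs) j
entry-suc []       m vs zero    = refl
entry-suc []       m vs (suc j) = refl
entry-suc (u ∷ us) m vs zero    = refl
entry-suc (u ∷ us) m vs (suc j) = entry-suc us m vs j

occurrences-cons : ∀ j x w → occurrences j (x ∷ w) ≡ indicator j x + occurrences j w
occurrences-cons j x w with j ≟ x
... | yes refl = trans (cong length (filter-accept (j ≟_) refl))
                       (cong (_+ occurrences j w) (sym (indicator-refl j)))
... | no  j≢x  = trans (cong length (filter-reject (j ≟_) j≢x))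
                       (cong (_+ occurrences j w) (sym (indicator-≢ j x j≢x)))

occurrences-∉ : ∀ {x w} → x ∉ w → occurrences x w ≡ 0
occurrences-∉ {x} x∉w = cong length (filter-none (x ≟_) (All.¬Any⇒All¬ _ x∉w))

occurrences⇒∈ : ∀ {x w} → 0 < occurrences x w → x ∈ w
occurrences⇒∈ {x} {w} 0<n with x ∈? w
... | yes x∈w = x∈w
... | no  x∉w = contradiction 0<n (n≮0 ∘ subst (0 <_) (occurrences-∉ x∉w))

-- Prepending the multiplicity 0 of the letter 0 turns letters into indices.
hasContent⇔ : ∀ {ms w} → HasContent ms w ⇔ (∀ x → occurrences x w ≡ entry (0 ∷ ms) x)
hasContent⇔ {ms} {w} = mk⇔ forth back
  where
  forth : HasContent ms w → ∀ x → occurrences x w ≡ entry (0 ∷ ms) x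
  forth (mkHasContent letters mult) zero    = occurrences-∉ λ 0∈w → n≮0 (proj₁ (All.lookup letters 0∈w))
  forth (mkHasContent letters mult) (suc j) with j <? length ms
  ... | yes j<n = begin
    occurrences (suc j) w                    ≡⟨ cong (λ i → occurrences (suc i) w) (Fin.toℕ-fromℕ< j<n) ⟨
    occurrences (suc (toℕ (Fin.fromℕ< j<n))) w ≡⟨ mult (Fin.fromℕ< j<n) ⟩
    lookup ms (Fin.fromℕ< j<n)               ≡⟨ entry-lookup ms (Fin.fromℕ< j<n) ⟨
    entry ms (toℕ (Fin.fromℕ< j<n))          ≡⟨ cong (entry ms) (Fin.toℕ-fromℕ< j<n) ⟩
    entry ms j                               ∎
    where open ≡-Reasoning
  ... | no  j≮n = trans (occurrences-∉ λ x∈w → j≮n (proj₂ (All.lookup letters x∈w)))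
                        (sym (entry-beyond ms (≮⇒≥ j≮n)))

  back : (∀ x → occurrences x w ≡ entry (0 ∷ ms) x) → HasContent ms w
  back occ = mkHasContent (All.tabulate (λ {x} x∈w → bounds x (filter-some (x ≟_) x∈w)))
                          (λ j → trans (occ (suc (toℕ j))) (entry-lookup ms j))
    where
    bounds : ∀ x → 0 < occurrences x w → 1 ≤ x × x ≤ length ms
    bounds zero    0<n = contradiction (subst (0 <_) (occ 0) 0<n) n≮0
    bounds (suc j) 0<n with j <? length ms
    ... | yes j<n = z<s , j<n
    ... | no  j≮n = contradiction (subst (0 <_) (trans (occ (suc j)) (entry-beyond ms (≮⇒≥ j≮n))) 0<n) n≮0

hasContent-resp : ∀ {ms ns w} → (∀ j → entry ms j ≡ entry ns j) → HasContent ms w → HasContent ns w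
hasContent-resp {ms} {ns} eq c = from hasContent⇔ λ x → trans (to hasContent⇔ c x) (eq∷ x)
  where
  eq∷ : ∀ x → entry (0 ∷ ms) x ≡ entry (0 ∷ ns) x
  eq∷ zero    = refl
  eq∷ (suc j) = eq j

-- Prepending `x` to the word and raising the multiplicity at its place add the same `indicator` to
-- both counts, which can be cancelled.
hasContent-∷ : ∀ us {m vs ms x w} → ms ≡ us ++ suc m ∷ vs → x ≡ suc (length us) →
  HasContent ms (x ∷ w) ⇔ HasContent (us ++ m ∷ vs) w
hasContent-∷ us {m} {vs} {w = w} refl refl = mk⇔
  (λ c → from hasContent⇔ λ x → +-cancelˡ-≡ (indicator x (suc (length us))) _ _
    (trans (sym (occurrences-cons x _ w)) (trans (to hasContent⇔ c x) (entry-suc (0 ∷ us) m vs x))))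
  (λ c → from hasContent⇔ λ x → trans (occurrences-cons x _ w)
    (trans (cong (indicator x (suc (length us)) +_) (to hasContent⇔ c x)) (sym (entry-suc (0 ∷ us) m vs x))))

hasContent⇒∈ : ∀ {ms w y} → All (1 ≤_) ms → HasContent ms w → 1 ≤ y → y ≤ length ms → y ∈ w
hasContent⇒∈ {y = suc j} 1≤ms c _ j<n =
  occurrences⇒∈ (subst (0 <_) (sym (to hasContent⇔ c (suc j))) (entry-positive 1≤ms j<n))

length-content-list : ∀ r a b L → length (content r a b L) ≡ suc a + length L
length-content-list r a b L = trans (length-++ (replicate a r))
  (trans (cong (_+ suc (length L)) (length-replicate a)) (+-suc a (length L)))

-- Counted words with the first letter removed.

content-positive : ∀ {r b L} a → 1 ≤ r → 1 ≤ b → All (1 ≤_) L → All (1 ≤_) (content r a b L)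
content-positive a 1≤r 1≤b 1≤L = All.++⁺ (All.replicate⁺ a 1≤r) (1≤b ∷ 1≤L)

-- Isolates the multiplicity of the letter `suc i`. Once it is lowered by one, the list is again a
-- `content`, with `i` full letters in front and the lowered entry in the role of `b`.
content-split : ∀ r {a i} b L → i < a →
  content r a b L ≡ replicate i r ++ r ∷ content r (a ∸ suc i) b L
content-split r {suc a} {zero}  b L _         = refl
content-split r {suc a} {suc i} b L (s≤s i<a) = cong (r ∷_) (content-split r b L i<a)

counted⇔ : ∀ {k r a b L w} →
  Counted k r a b L w ⇔ (HasContent (content r a b L) w × NoRuns k (suc a ∷ w))
counted⇔ {a = a} {w = w} = mk⇔
  (λ (mkCounted c _ p) → c , to avoidsBoth⇔noRuns p)
  (λ (c , p) → mkCounted c (from avoidsBoth⇔noRuns (noRuns-⊆ (suc a ∷ʳ ⊆-refl) p)) (from avoidsBoth⇔noRuns p))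

-- The deleted letter `x` becomes the prefixed letter of the shorter word, and by `noRuns-absorb`
-- the old prefix `suc a` in front of it imposes nothing new.
counted-low : ∀ {k r a b L x w} → 1 ≤ x → x ≤ a →
  Counted k (suc r) a b L (x ∷ w) ⇔ Counted k (suc r) (x ∸ 1) r (replicate (a ∸ x) (suc r) ++ b ∷ L) w
counted-low {k} {r} {a} {b} {L} {suc i} {w} _ i<a = mk⇔
  (λ c → let (h , n) = to counted⇔ c in from counted⇔ (to peel h , noRuns-⊆ (suc a ∷ʳ ⊆-refl) n))
  (λ c → let (h , n) = to counted⇔ c in from counted⇔ (from peel h , noRuns-absorb (m≤n⇒m≤1+n i<a) n))
  where
  peel : HasContent (content (suc r) a b L) (suc i ∷ w) ⇔
         HasContent (replicate i (suc r) ++ r ∷ content (suc r) (a ∸ suc i) b L) w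
  peel = hasContent-∷ (replicate i (suc r)) (content-split (suc r) b L i<a)
           (cong suc (sym (length-replicate i)))

counted-middle : ∀ {k r a b L w} → Counted k r a (suc b) L (suc a ∷ w) ⇔ Counted k r a b L w
counted-middle {k} {r} {a} {b} {L} {w} = mk⇔
  (λ c → let (h , n) = to counted⇔ c in from counted⇔ (to peel h , noRuns-⊆ (suc a ∷ʳ ⊆-refl) n))
  (λ c → let (h , n) = to counted⇔ c in from counted⇔ (from peel h , noRuns-absorb ≤-refl n))
  where
  peel : HasContent (content r a (suc b) L) (suc a ∷ w) ⇔ HasContent (content r a b L) w
  peel = hasContent-∷ (replicate a r) refl (cong suc (sym (length-replicate a)))

R-∷ʳ-suc : ∀ {M} l → All (1 ≤_) M → R (M ++ suc l ∷ []) ≡ M ++ suc l ∷ []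
R-∷ʳ-suc l 1≤M = filter-all _ (All.++⁺ (All.map m<n⇒n≢0 1≤M) ((λ ()) ∷ []))

R-∷ʳ-0 : ∀ {M} → All (1 ≤_) M → R (M ++ 0 ∷ []) ≡ M
R-∷ʳ-0 {M} 1≤M = trans (filter-++ _ M (0 ∷ []))
  (trans (++-identityʳ (R M)) (filter-all _ (All.map m<n⇒n≢0 1≤M)))

-- Only the last entry can be 0. If it is, `R` drops a trailing zero, which `entry` does not detect;
-- otherwise `R` changes nothing.
entry-R : ∀ r a b {M} l → All (1 ≤_) M → ∀ j →
  entry (content r a b (R (M ++ l ∷ []))) j ≡ entry (content r a b (M ++ l ∷ [])) j
entry-R r a b     (suc l) 1≤M j = cong (λ L → entry (content r a b L) j) (R-∷ʳ-suc l 1≤M)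
entry-R r a b {M} zero    1≤M j = begin
  entry (content r a b (R (M ++ 0 ∷ []))) j ≡⟨ cong (λ L → entry (content r a b L) j) (R-∷ʳ-0 1≤M) ⟩
  entry (content r a b M) j                 ≡⟨ entry-∷ʳ-0 (content r a b M) j ⟨
  entry (content r a b M ++ 0 ∷ []) j       ≡⟨ cong (λ ms → entry ms j) (++-assoc (replicate a r) (b ∷ M) (0 ∷ [])) ⟩
  entry (content r a b (M ++ 0 ∷ [])) j     ∎
  where open ≡-Reasoning

decrementLast-∷ʳ : ∀ M l → decrementLast (M ++ l ∷ []) ≡ M ++ l ∸ 1 ∷ []
decrementLast-∷ʳ []          l = refl
decrementLast-∷ʳ (m ∷ [])    l = refl
decrementLast-∷ʳ (m ∷ n ∷ M) l = cong (m ∷_) (decrementLast-∷ʳ (n ∷ M) l)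

hasContent-top : ∀ {r a b L w} → All (1 ≤_) L → 0 < length L →
  HasContent (content r a b L) (suc a + length L ∷ w) ⇔ HasContent (content r a b (R (decrementLast L))) w
hasContent-top {r} {a} {b} {L} {w} 1≤L 0<len with initLast L
... | M ∷ʳ′ zero  with () ← All.head (All.++⁻ʳ M 1≤L)
... | M ∷ʳ′ suc l = mk⇔
  (hasContent-resp (λ j → trans (cong (λ ms → entry ms j) init-l)
    (trans (sym (entry-R r a b l 1≤M j)) (cong (λ N → entry (content r a b (R N)) j) (sym decrement)))) ∘ to peel)
  (from peel ∘ hasContent-resp (λ j → trans (cong (λ N → entry (content r a b (R N)) j) decrement)
    (trans (entry-R r a b l 1≤M j) (cong (λ ms → entry ms j) (sym init-l)))))
  where
  1≤M : All (1 ≤_) M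
  1≤M = All.++⁻ˡ M 1≤L

  decrement : decrementLast (M ++ suc l ∷ []) ≡ M ++ l ∷ []
  decrement = decrementLast-∷ʳ M (suc l)

  init-l : content r a b M ++ l ∷ [] ≡ content r a b (M ++ l ∷ [])
  init-l = ++-assoc (replicate a r) (b ∷ M) (l ∷ [])

  top≡ : suc a + length (M ++ suc l ∷ []) ≡ suc (length (content r a b M))
  top≡ = begin
    suc a + length (M ++ suc l ∷ []) ≡⟨ cong (suc a +_) (trans (length-++ M) (+-comm (length M) 1)) ⟩
    suc a + suc (length M)           ≡⟨ cong suc (+-suc a (length M)) ⟩
    suc (suc a + length M)           ≡⟨ cong suc (length-content-list r a b M) ⟨
    suc (length (content r a b M))   ∎
    where open ≡-Reasoning

  peel : HasContent (content r a b (M ++ suc l ∷ [])) (suc a + length (M ++ suc l ∷ []) ∷ w) ⇔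
         HasContent (content r a b M ++ l ∷ []) w
  peel = hasContent-∷ (content r a b M) (sym (++-assoc (replicate a r) (b ∷ M) (suc l ∷ []))) top≡

-- Deletion passes to a sublist. Reinsertion is `noRuns-insertMax` with `c = suc a` and
-- `t = length L`; the content of the enlarged word bounds its letters.
counted-top : ∀ {k r a b L w} → 3 ≤ k → All (1 ≤_) L → length L ≤ k ∸ 2 → 0 < length L →
  Counted k r a b L (suc a + length L ∷ w) ⇔ Counted k r a b (R (decrementLast L)) w
counted-top {k} {r} {a} {b} {L} {w} 3≤k 1≤L len≤k 0<len = mk⇔
  (λ c → let (h , n) = to counted⇔ c in
    from counted⇔ (to peel h , noRuns-⊆ (refl ∷ (suc a + length L) ∷ʳ ⊆-refl) n))
  (λ c → let (h , n) = to counted⇔ c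
             h′      = from peel h in
    from counted⇔ (h′ , noRuns-insertMax 3≤k len≤k (w≤top h′) n))
  where
  peel : HasContent (content r a b L) (suc a + length L ∷ w) ⇔ HasContent (content r a b (R (decrementLast L))) w
  peel = hasContent-top 1≤L 0<len

  w≤top : HasContent (content r a b L) (suc a + length L ∷ w) → All (_≤ suc a + length L) w
  w≤top (mkHasContent (_ ∷ bounds) _) =
    All.map (λ (_ , x≤n) → subst (_ ≤_) (length-content-list r a b L) x≤n) bounds

-- Possible first letters, one case for each term of the recurrence.

data FirstLetter (k a t : ℕ) : ℕ → Set where
  low    : ∀ {x} → lowerLimit k a t ≤ x → x ≤ a → FirstLetter k a t x
  middle : FirstLetter k a t (suc a)
  top    : 0 < t → FirstLetter k a t (suc a + t)

-- All multiplicities are positive, so every letter up to `suc a + t` occurs; large letters that are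
-- present restrict `x`.
firstLetter : ∀ {k r a b L x w} → 3 ≤ k → 1 ≤ r → 1 ≤ b → All (1 ≤_) L →
  Counted k r a b L (x ∷ w) → FirstLetter k a (length L) x
firstLetter {k@(suc (suc k-2))} {r} {a} {b} {L} {x} {w} (s≤s (s≤s _)) 1≤r 1≤b 1≤L counted =
  classify (<-cmp x (suc a))
  where
  t : ℕ
  t = length L

  hasContent : HasContent (content r a b L) (x ∷ w)
  hasContent = proj₁ (to counted⇔ counted)

  noRuns : NoRuns k (suc a ∷ x ∷ w)
  noRuns = proj₂ (to counted⇔ counted)

  letter∈ : ∀ {y} → 1 ≤ y → y ≤ suc a + t → y ∈ x ∷ w
  letter∈ 1≤y y≤n = hasContent⇒∈ (content-positive a 1≤r 1≤b 1≤L) hasContent 1≤y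
    (subst (_ ≤_) (sym (length-content-list r a b L)) y≤n)

  bounds : 1 ≤ x × x ≤ suc a + t
  bounds with h , x≤n ← All.head (HasContent.letters hasContent) =
    h , subst (x ≤_) (length-content-list r a b L) x≤n

  belowGap : a + t + 1 ≤ x + k-2
  -- Otherwise the `k ∸ 1` values after `x` are all letters of the word. They differ from `x`, hence
  -- stand behind it, against `noRuns-gap`.
  belowGap = ≮⇒≥ λ x+k-2<n → noRuns-gap (noRuns-⊆ (suc a ∷ʳ ⊆-refl) noRuns) λ j j<k-1 →
    ∈-tail (<⇒≢ (m≤m+n (suc x) j) ∘ sym)
      (letter∈ z<s (begin
        suc x + j       ≡⟨ +-suc x j ⟨
        x + suc j       ≤⟨ +-monoʳ-≤ x j<k-1 ⟩
        x + suc k-2     ≡⟨ +-suc x k-2 ⟩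
        suc (x + k-2)   ≤⟨ x+k-2<n ⟩
        a + t + 1       ≡⟨ +-comm (a + t) 1 ⟩
        suc a + t       ∎))
    where open ≤-Reasoning

  classify : Tri (x < suc a) (x ≡ suc a) (x > suc a) → FirstLetter k a t x
  classify (tri< x≤a _ _)  = low (⊔-lub (proj₁ bounds) (m≤n+o⇒m∸n≤o (a + t + 1) k-2
    (subst (a + t + 1 ≤_) (+-comm x k-2) belowGap))) (s≤s⁻¹ x≤a)
  classify (tri≈ _ refl _) = middle
  classify (tri> _ _ x>sa) = subst (FirstLetter k a t) (sym x≡top)
    (top (+-cancelˡ-< (suc a) 0 t (subst (_< suc a + t) (sym (+-identityʳ (suc a))) (<-≤-trans x>sa (proj₂ bounds)))))
    where
    top≤x : suc a + t ≤ x
    -- The largest letter occurs; if it stands behind `x`, then `∈-maximal` with the prefix `suc a`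
    -- bounds it by `x`.
    top≤x with letter∈ z<s ≤-refl
    ... | here e    = ≤-reflexive e
    ... | there top∈w = ∈-maximal noRuns x>sa top∈w

    x≡top : x ≡ suc a + t
    x≡top = ≤-antisym (proj₂ bounds) top≤x

-- Enumerations and their cardinalities.

cardinality-cong : ∀ {P Q : Pred Word 0ℓ} (E : Enumeration P) (F : Enumeration Q) →
  (∀ w → P w ⇔ Q w) → cardinality E ≡ cardinality F
-- Duplicate-free lists with the same members are permutations of each other.
cardinality-cong E F P⇔Q = ↭-length (∼bag⇒↭ (unique∧set⇒bag E.unique F.unique λ {w} →
  mk⇔ (from (F.complete w) ∘ to (P⇔Q w) ∘ to (E.complete w))
      (from (E.complete w) ∘ from (P⇔Q w) ∘ to (F.complete w))))
  where
  module E = Enumeration E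
  module F = Enumeration F

Prefixed : ℕ → Pred Word 0ℓ → Pred Word 0ℓ
Prefixed x P w = ∃ λ v → w ≡ x ∷ v × P v

prefixed : ∀ {P} x → Enumeration P → Enumeration (Prefixed x P)
prefixed x E = record
  { elements = map (x ∷_) elements
  ; unique   = Unique.map⁺ ∷-injectiveʳ unique
  ; complete = λ w → mk⇔
      (λ w∈ → let (v , v∈ , w≡) = ∈-map⁻ (x ∷_) w∈ in v , w≡ , to (complete v) v∈)
      (λ { (v , refl , p) → ∈-map⁺ (x ∷_) (from (complete v) p) })
  }
  where open Enumeration E

cardinality-prefixed : ∀ {P} x (E : Enumeration P) → cardinality (prefixed x E) ≡ cardinality E
cardinality-prefixed x E = length-map (x ∷_) (Enumeration.elements E)

union : ∀ {P Q : Pred Word 0ℓ} → (∀ {w} → P w → Q w → ⊥) → Enumeration P → Enumeration Q →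
  Enumeration (λ w → P w ⊎ Q w)
union disjoint E F = record
  { elements = E.elements ++ F.elements
  ; unique   = Unique.++⁺ E.unique F.unique
      λ { {w} (w∈E , w∈F) → disjoint (to (E.complete w) w∈E) (to (F.complete w) w∈F) }
  ; complete = λ w → mk⇔
      (Sum.map (to (E.complete w)) (to (F.complete w)) ∘ ∈-++⁻ E.elements)
      Sum.[ ∈-++⁺ˡ ∘ from (E.complete w) , ∈-++⁺ʳ E.elements ∘ from (F.complete w) ]
  }
  where
  module E = Enumeration E
  module F = Enumeration F

cardinality-union : ∀ {P Q : Pred Word 0ℓ} (disjoint : ∀ {w} → P w → Q w → ⊥) →
  (E : Enumeration P) (F : Enumeration Q) →
  cardinality (union disjoint E F) ≡ cardinality E + cardinality F
cardinality-union disjoint E F = length-++ (Enumeration.elements E)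

module _ {P : ℕ → Pred Word 0ℓ} (disjoint : ∀ {i j w} → P i w → P j w → i ≡ j)
         (E : ∀ i → Enumeration (P i)) where

  private
    module E i = Enumeration (E i)

  ⋃ : ∀ n → Enumeration (λ w → ∃ λ i → i < n × P i w)
  ⋃ n = record
    { elements = concatMap E.elements (upTo n)
    ; unique   = Unique.concat⁺ (All.map⁺ (All.universal E.unique (upTo n)))
        (AllPairs.map⁺ (AllPairs.map
          (λ { {i} {j} i≢j {w} (w∈i , w∈j) → i≢j (disjoint (to (E.complete i w) w∈i) (to (E.complete j w) w∈j)) })
          (Unique.upTo⁺ n)))
    ; complete = λ w → mk⇔
        (λ w∈ → let (i , i∈ , w∈i) = find (∈-concatMap⁻ E.elements {xs = upTo n} w∈) in
          i , ∈-upTo⁻ i∈ , to (E.complete i w) w∈i)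
        (λ (i , i<n , p) → ∈-concatMap⁺ E.elements (lose (∈-upTo⁺ i<n) (from (E.complete i w) p)))
    }

  cardinality-⋃ : ∀ n → cardinality (⋃ n) ≡ sum (map (λ i → cardinality (E i)) (upTo n))
  cardinality-⋃ n = length-concatMap (upTo n)
    where
    length-concatMap : ∀ is → length (concatMap E.elements is) ≡ sum (map (λ i → cardinality (E i)) is)
    length-concatMap []       = refl
    length-concatMap (i ∷ is) = trans (length-++ (E.elements i)) (cong (cardinality (E i) +_) (length-concatMap is))

-- Set-level counterpart of the factor `δ[ n ≥1]`.
guarded : ∀ n {P : Pred Word 0ℓ} → Enumeration P → Enumeration (λ w → 0 < n × P w)
guarded zero    E = record { elements = [] ; unique = [] ; complete = λ w → mk⇔ (λ ()) (λ { (() , _) }) }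
guarded (suc n) E = record
  { elements = elements
  ; unique   = unique
  ; complete = λ w → mk⇔ (λ w∈ → z<s , to (complete w) w∈) (λ (_ , p) → from (complete w) p)
  }
  where open Enumeration E

cardinality-guarded : ∀ n {P : Pred Word 0ℓ} (E : Enumeration P) →
  cardinality (guarded n E) ≡ δ[ n ≥1] * cardinality E
cardinality-guarded zero    E = refl
cardinality-guarded (suc n) E = sym (*-identityˡ (cardinality E))

-- The recurrence by sorting words by first letter.

module _ {k : ℕ} (3≤k : 3 ≤ k) (r a b : ℕ) {L : List ℕ} (1≤L : All (1 ≤_) L)
         (len≤k : length L ≤ k ∸ 2) where

  private
    lo : ℕ
    lo = lowerLimit k a (length L)

    -- The number of summands from `lo` to `a`, which is 0 when `lo` exceeds `a`, as in `sumFromTo`.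
    count : ℕ
    count = suc a ∸ lo

    -- The multiplicities are `suc r` and `suc b`, so that `r` and `b` themselves are the
    -- decremented values in the recurrence.
    IsCounted : Pred Word 0ℓ
    IsCounted = Counted k (suc r) a (suc b) L

    LowRest : ℕ → Pred Word 0ℓ
    LowRest i = Counted k (suc r) (i ∸ 1) r (replicate (a ∸ i) (suc r) ++ suc b ∷ L)

    lowRest : ∀ i → Enumeration (LowRest i)
    lowRest i = enumeration k (suc r) (i ∸ 1) r (replicate (a ∸ i) (suc r) ++ suc b ∷ L)

    StartsLow : Pred Word 0ℓ
    StartsLow w = ∃ λ j → j < count × Prefixed (lo + j) (LowRest (lo + j)) w

    StartsMiddle : Pred Word 0ℓ
    StartsMiddle = Prefixed (suc a) (Counted k (suc r) a b L)

    1≤lo : 1 ≤ lo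
    1≤lo = m≤m⊔n 1 (a + length L + 1 ∸ (k ∸ 2))

    low≤a : ∀ {j} → j < count → lo + j ≤ a
    low≤a {j} j<count = s≤s⁻¹ (subst (_≤ suc a) (cong suc (+-comm j lo))
      -- Undoing the truncated subtraction needs `lo ≤ suc a`, which holds because `count` exceeds
      -- `j` and so is not 0.
      (m≤o∸n⇒m+n≤o (suc j) (<⇒≤ (m∸n≢0⇒n<m (m<n⇒n≢0 j<count))) j<count))

    low-disjoint : ∀ {i j w} → Prefixed (lo + i) (LowRest (lo + i)) w → Prefixed (lo + j) (LowRest (lo + j)) w →
      i ≡ j
    low-disjoint {i} {j} (_ , refl , _) (_ , eq , _) = +-cancelˡ-≡ lo i j (∷-injectiveˡ eq)

    startsAt : ∀ j → Enumeration (Prefixed (lo + j) (LowRest (lo + j)))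
    startsAt j = prefixed (lo + j) (lowRest (lo + j))

    startsLow : Enumeration StartsLow
    startsLow = ⋃ low-disjoint startsAt count

    startsMiddle : Enumeration StartsMiddle
    startsMiddle = prefixed (suc a) (enumeration k (suc r) a b L)

    low≢middle : ∀ {w} → StartsLow w → StartsMiddle w → ⊥
    low≢middle (j , j<count , _ , refl , _) (_ , eq , _) =
      <⇒≢ (s≤s (low≤a j<count)) (∷-injectiveˡ eq)

    TopRest : Pred Word 0ℓ
    TopRest = Counted k (suc r) a (suc b) (R (decrementLast L))

    topRest : Enumeration TopRest
    topRest = enumeration k (suc r) a (suc b) (R (decrementLast L))

    StartsTop : Pred Word 0ℓ
    StartsTop w = 0 < length L × Prefixed (suc a + length L) TopRest w

    startsTop : Enumeration StartsTop
    startsTop = guarded (length L) (prefixed (suc a + length L) topRest)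

    StartsBelowTop : Pred Word 0ℓ
    StartsBelowTop w = StartsLow w ⊎ StartsMiddle w

    startsBelowTop : Enumeration StartsBelowTop
    startsBelowTop = union low≢middle startsLow startsMiddle

    belowTop≢top : ∀ {w} → StartsBelowTop w → StartsTop w → ⊥
    belowTop≢top (inj₁ (j , j<count , _ , refl , _)) (_ , _ , eq , _) =
      <⇒≢ (m≤n⇒m≤n+o (length L) (s≤s (low≤a j<count))) (∷-injectiveˡ eq)
    belowTop≢top (inj₂ (_ , refl , _)) (0<t , _ , eq , _) = <⇒≢ (m<m+n (suc a) 0<t) (∷-injectiveˡ eq)

    starts : Enumeration (λ w → StartsBelowTop w ⊎ StartsTop w)
    starts = union belowTop≢top startsBelowTop startsTop

    counted⇒starts : ∀ w → IsCounted w → StartsBelowTop w ⊎ StartsTop w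
    -- The empty word is excluded because the letter 1 has positive multiplicity.
    counted⇒starts [] c with () ← hasContent⇒∈ (content-positive {suc r} {suc b} a z<s z<s 1≤L)
      (Counted.hasContent c) ≤-refl (subst (1 ≤_) (sym (length-content-list (suc r) a (suc b) L)) z<s)
    counted⇒starts (x ∷ v) c with firstLetter 3≤k z<s z<s 1≤L c
    ... | low lo≤x x≤a = inj₁ (inj₁ (x ∸ lo , ∸-monoˡ-< (s≤s x≤a) lo≤x ,
            subst (λ y → Prefixed y (LowRest y) (x ∷ v)) (sym (m+[n∸m]≡n lo≤x))
              (v , refl , to (counted-low (≤-trans 1≤lo lo≤x) x≤a) c)))
    ... | middle       = inj₁ (inj₂ (v , refl , to counted-middle c))
    ... | top 0<t      = inj₂ (0<t , v , refl , to (counted-top 3≤k 1≤L len≤k 0<t) c)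

    starts⇒counted : ∀ w → StartsBelowTop w ⊎ StartsTop w → IsCounted w
    starts⇒counted w (inj₁ (inj₁ (j , j<count , _ , refl , c))) =
      from (counted-low (m≤n⇒m≤n+o j 1≤lo) (low≤a j<count)) c
    starts⇒counted w (inj₁ (inj₂ (_ , refl , c)))               = from counted-middle c
    starts⇒counted w (inj₂ (0<t , _ , refl , c))                = from (counted-top 3≤k 1≤L len≤k 0<t) c

    cardinality-startsLow : cardinality startsLow ≡ sumFromTo lo a (λ i → cardinality (lowRest i))
    cardinality-startsLow = trans (cardinality-⋃ low-disjoint startsAt count)
      (cong sum (map-cong (λ j → cardinality-prefixed (lo + j) (lowRest (lo + j))) (upTo count)))

    cardinality-startsMiddle : cardinality startsMiddle ≡ A k (suc r) a b L
    cardinality-startsMiddle = cardinality-prefixed (suc a) (enumeration k (suc r) a b L)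

    cardinality-startsTop : cardinality startsTop ≡ δ[ length L ≥1] * cardinality topRest
    cardinality-startsTop = trans
      (cardinality-guarded (length L) (prefixed (suc a + length L) topRest))
      (cong (δ[ length L ≥1] *_) (cardinality-prefixed (suc a + length L) topRest))

    cardinality-starts : cardinality starts ≡ cardinality startsLow + cardinality startsMiddle + cardinality startsTop
    cardinality-starts = trans (cardinality-union belowTop≢top startsBelowTop startsTop)
      (cong (_+ cardinality startsTop) (cardinality-union low≢middle startsLow startsMiddle))

  recurrence : A k (suc r) a (suc b) L ≡
    sumFromTo lo a (λ i → cardinality (lowRest i)) + A k (suc r) a b L + δ[ length L ≥1] * cardinality topRest
  recurrence = trans (cardinality-cong (enumeration k (suc r) a (suc b) L) starts
                       (λ w → mk⇔ (counted⇒starts w) (starts⇒counted w)))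
    (trans cardinality-starts
      (cong₂ _+_ (cong₂ _+_ cardinality-startsLow cardinality-startsMiddle) cardinality-startsTop))

theorem2 : (k r : ℕ) → 3 ≤ k → 1 ≤ r →
    (a b : ℕ) (L : List ℕ) → b ≤ r → All (λ l → 1 ≤ l) L →
    1 ≤ b → length L ≤ k ∸ 2 →
    A k r a b L ≡
    sumFromTo (lowerLimit k a (length L)) a (λ i → A k r (i ∸ 1) (r ∸ 1) (replicate (a ∸ i) r ++ b ∷ L))
    + A k r a (b ∸ 1) L
    + δ[ length L ≥1] * A k r a b (R (decrementLast L))
-- With `r` and `b` as successors, `r ∸ 1` and `b ∸ 1` compute to the parameters of `recurrence`.
theorem2 k (suc r) 3≤k _ a (suc b) L _ 1≤L _ len≤k = recurrence 3≤k r a b 1≤L len≤k
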